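{- Let $q$ be a prime power, let $n\ge k\ge1$ be integers, and let $\mathcal{C}$ be a nondegenerate $[n,k,d]_q$ code of maximum weight $w$. Then $$\frac1n\le\frac{q-1}{q^k-1}+\frac14\left(\frac{w-d}{n}\right)^2\frac{q^k-1}{q^{k-2}(q-1)}.$$
   Context: The weight $\omega(v)$ of $v\in\mathbb{F}_q^n$ is the number of its nonzero coordinates. An $[n,k,d]_q$ code is an $\mathbb{F}_q$-linear subspace $\mathcal{C}\subseteq\mathbb{F}_q^n$ of dimension $k\ge1$ with minimum distance $d=\min\{\omega(c): c\in\mathcal{C},\ c\neq 0\}$; its maximum weight is $\max\{\omega(c): c\in\mathcal{C}\}$. It is nondegenerate if there is no coordinate $i$ with $c_i=0$ for all $c\in\mathcal{C}$. -}

module Defs where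

open import Algebra.Apartness.Bundles using (HeytingField; HeytingCommutativeRing)
open import Algebra.Bundles using (CommutativeRing)
import Algebra.Definitions.RawSemiring as RawSemiringDefinitions
import Algebra.Properties.Monoid.Sum as MonoidSum
open import Data.Fin.Base using (Fin)
import Data.Fin.Properties as Fin
open import Data.Integer.Base as ℤ using (ℤ; +_; -[1+_])
import Data.Integer.Properties as ℤ
open import Data.Nat.Base as ℕ using (ℕ; zero; suc; s≤s; z≤n)
open import Data.Nat.Primality using (Prime; prime⇒nonTrivial)
import Data.Nat.Properties as ℕ
open import Data.Product.Base using (∃; ∃₂; _×_; _,_)
open import Data.Rational.Base as ℚ using (ℚ; 1ℚ; 1/_)
import Data.Rational.Properties as ℚ
import Data.Rational.Unnormalised.Base as ℚᵘ
import Data.Rational.Unnormalised.Properties as ℚᵘ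
open import Data.Vec.Base using (count; tabulate)
open import Data.Vec.Functional using (Vector)
import Data.Vec.Functional.Relation.Binary.Equality.Setoid as VectorEquality
open import Function.Bundles using (Inverse)
open import Function.Properties.Inverse using (Inverse⇒Injection)
open import Level using (Level; _⊔_) renaming (suc to lsuc)
open import Relation.Binary.Definitions using (Decidable; _Respects_)
open import Relation.Binary.PropositionalEquality as ≡ using (_≡_; refl)
open import Relation.Nullary.Decidable using (¬?; via-injection)
open import Relation.Nullary.Negation using (¬_)
open import Relation.Unary using (Pred; _∈_)

IsPrimePower : ℕ → Set
IsPrimePower q = ∃₂ λ p e → Prime p × 1 ℕ.≤ e × q ≡ p ℕ.^ e

-- On a finite carrier equality is decidable and the (tight) apartness
-- relation of a Heyting field is just inequality, so these are exactly the
-- fields with q elements, the elements being counted up to _≈_.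

record FiniteField (q : ℕ) (c ℓ₁ ℓ₂ : Level) : Set (lsuc (c ⊔ ℓ₁ ⊔ ℓ₂)) where
  field
    heytingField : HeytingField c ℓ₁ ℓ₂

  open HeytingField heytingField using (heytingCommutativeRing)
  open HeytingCommutativeRing heytingCommutativeRing using (commutativeRing)
  open CommutativeRing commutativeRing public

  field
    enumeration : Inverse setoid (≡.setoid (Fin q))

  _≟_ : Decidable _≈_
  _≟_ = via-injection (Inverse⇒Injection enumeration) Fin._≟_

IsMinimum : ∀ {a} → Pred ℕ a → ℕ → Set a
IsMinimum P m = m ∈ P × (∀ {x} → x ∈ P → m ℕ.≤ x)

IsMaximum : ∀ {a} → Pred ℕ a → ℕ → Set a
IsMaximum P m = m ∈ P × (∀ {x} → x ∈ P → x ℕ.≤ m)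

module LinearCodes {q c ℓ₁ ℓ₂} (F : FiniteField q c ℓ₁ ℓ₂) where

  open FiniteField F
  open VectorEquality setoid public using (_≋_)
  open MonoidSum +-monoid using (sum)

  Word : ℕ → Set c
  Word n = Vector Carrier n

  module _ {n : ℕ} where

    0ᵂ : Word n
    0ᵂ _ = 0#

    _+ᵂ_ : Word n → Word n → Word n
    (u +ᵂ v) i = u i + v i

    _*ᵂ_ : Carrier → Word n → Word n
    (a *ᵂ v) i = a * v i

    linearCombination : ∀ {k} → Vector Carrier k → Vector (Word n) k → Word n
    linearCombination a b i = sum (λ j → a j * b j i)

    ω : Word n → ℕ
    ω v = count (λ x → ¬? (x ≟ 0#)) (tabulate v)

    module _ {ℓ} (C : Pred (Word n) ℓ) where

      record IsSubspace : Set (c ⊔ ℓ₁ ⊔ ℓ) where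
        field
          resp-≋    : C Respects _≋_
          0ᵂ-closed : 0ᵂ ∈ C
          +ᵂ-closed : ∀ {u v} → u ∈ C → v ∈ C → (u +ᵂ v) ∈ C
          *ᵂ-closed : ∀ a {v} → v ∈ C → (a *ᵂ v) ∈ C

      record IsBasis {k} (b : Vector (Word n) k) : Set (c ⊔ ℓ₁ ⊔ ℓ) where
        field
          members     : ∀ j → b j ∈ C
          independent : ∀ a → linearCombination a b ≋ 0ᵂ → ∀ j → a j ≈ 0#
          spanning    : ∀ {v} → v ∈ C → ∃ λ a → v ≋ linearCombination a b

      HasDimension : ℕ → Set (c ⊔ ℓ₁ ⊔ ℓ)
      HasDimension k = ∃ λ (b : Vector (Word n) k) → IsBasis b

      MinimumDistance : ℕ → Set (c ⊔ ℓ₁ ⊔ ℓ)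
      MinimumDistance = IsMinimum λ m → ∃ λ v → v ∈ C × ¬ (v ≋ 0ᵂ) × m ≡ ω v

      MaximumWeight : ℕ → Set (c ⊔ ℓ)
      MaximumWeight = IsMaximum λ m → ∃ λ v → v ∈ C × m ≡ ω v

      Nondegenerate : Set (c ⊔ ℓ₁ ⊔ ℓ)
      Nondegenerate = ¬ (∃ λ i → ∀ {v} → v ∈ C → v i ≈ 0#)

      -- The length n is carried by the type of C and q by F.
      record IsCode (k d : ℕ) : Set (c ⊔ ℓ₁ ⊔ ℓ) where
        field
          isSubspace      : IsSubspace
          dimension       : HasDimension k
          k≥1             : 1 ℕ.≤ k
          minimumDistance : MinimumDistance d

fromℕ : ℕ → ℚ
fromℕ m = + m ℚ./ 1

open RawSemiringDefinitions ℚ.+-*-rawSemiring public using (_^_)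

-- Integer exponents are needed since k - 2 is negative when k = 1.

infixr 8 _^ᶻ_
_^ᶻ_ : (p : ℚ) → .{{_ : ℚ.NonZero p}} → ℤ → ℚ
p ^ᶻ (+ m)    = p ^ m
p ^ᶻ -[1+ m ] = (1/ p) ^ suc m

primePower>1 : ∀ {q} → IsPrimePower q → 1 ℕ.< q
primePower>1 (p , e , pr , 1≤e , refl) = begin-strict
  1        <⟨ ℕ.nonTrivial⇒n>1 p ⟩
  p        ≡⟨ ℕ.^-identityʳ p ⟨
  p ℕ.^ 1  ≤⟨ ℕ.^-monoʳ-≤ p 1≤e ⟩
  p ℕ.^ e  ∎
  where
  open ℕ.≤-Reasoning
  instance
    p-nonTrivial : ℕ.NonTrivial p
    p-nonTrivial = prime⇒nonTrivial pr
    p-nonZero : ℕ.NonZero p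
    p-nonZero = ℕ.nonTrivial⇒nonZero p

private

  positive-fromℕ : ∀ {m} → 0 ℕ.< m → ℚ.Positive (fromℕ m)
  positive-fromℕ {m} 0<m = ℚ.normalize-pos m 1 {{_}} {{ℕ.>-nonZero 0<m}}

  1<fromℕ : ∀ {m} → 1 ℕ.< m → 1ℚ ℚ.< fromℕ m
  1<fromℕ {m} 1<m = ℚ.toℚᵘ-cancel-<
    (ℚᵘ.<-respʳ-≃ (ℚᵘ.≃-sym (ℚ.toℚᵘ-fromℚᵘ (ℚᵘ.mkℚᵘ (+ m) 0)))
      (ℚᵘ.*<* (ℤ.*-monoʳ-<-pos (+ 1) (ℤ.+<+ 1<m))))

  positive-p-1 : ∀ {p} → 1ℚ ℚ.< p → ℚ.Positive (p ℚ.- 1ℚ)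
  positive-p-1 {p} 1<p = ℚ.positive
    (ℚ.<-respˡ-≡ (ℚ.+-inverseʳ 1ℚ) (ℚ.+-monoˡ-< (ℚ.- 1ℚ) 1<p))

  positive-^ : ∀ p .{{_ : ℚ.Positive p}} m → ℚ.Positive (p ^ m)
  positive-^ p zero    = _
  positive-^ p (suc m) = ℚ.pos*pos⇒pos p (p ^ m) {{positive-^ p m}}

  positive-^ᶻ : ∀ p .{{_ : ℚ.Positive p}} .{{nz : ℚ.NonZero p}} z →
                ℚ.Positive (p ^ᶻ z)
  positive-^ᶻ p             (+ m)    = positive-^ p m
  positive-^ᶻ p {{nz = nz}} -[1+ m ] =
    positive-^ (1/_ p {{nz}}) {{ℚ.1/pos⇒pos p}} (suc m)

  1<^ : ∀ {p} → 1ℚ ℚ.< p → ∀ {k} → 1 ℕ.≤ k → 1ℚ ℚ.< p ^ k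
  1<^ {p} 1<p {suc zero}    _ = ℚ.<-respʳ-≡ (≡.sym (ℚ.*-identityʳ p)) 1<p
  1<^ {p} 1<p {suc (suc k)} _ = ℚ.<-trans 1<p
    (ℚ.<-respˡ-≡ (ℚ.*-identityʳ p)
      (ℚ.*-monoʳ-<-pos p {{ℚ.positive (ℚ.<-trans (ℚ.positive⁻¹ 1ℚ) 1<p)}}
        (1<^ 1<p {suc k} (s≤s z≤n))))

nonZero-fromℕ : ∀ {m} → 1 ℕ.≤ m → ℚ.NonZero (fromℕ m)
nonZero-fromℕ {m} 1≤m = ℚ.pos⇒nonZero (fromℕ m) {{positive-fromℕ 1≤m}}

module _ {q} (1<q : 1 ℕ.< q) where

  private
    instance
      Q-positive : ℚ.Positive (fromℕ q)
      Q-positive = positive-fromℕ (ℕ.<⇒≤ 1<q)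

    Q-1-positive : ℚ.Positive (fromℕ q ℚ.- 1ℚ)
    Q-1-positive = positive-p-1 (1<fromℕ 1<q)

  nonZero-Q^k-1 : ∀ {k} → 1 ℕ.≤ k → ℚ.NonZero (fromℕ q ^ k ℚ.- 1ℚ)
  nonZero-Q^k-1 {k} 1≤k = ℚ.pos⇒nonZero (fromℕ q ^ k ℚ.- 1ℚ)
    {{positive-p-1 (1<^ (1<fromℕ 1<q) 1≤k)}}

  nonZero-Q^z[Q-1] : .{{_ : ℚ.NonZero (fromℕ q)}} → ∀ z →
                     ℚ.NonZero (fromℕ q ^ᶻ z ℚ.* (fromℕ q ℚ.- 1ℚ))
  nonZero-Q^z[Q-1] z = ℚ.pos⇒nonZero (fromℕ q ^ᶻ z ℚ.* (fromℕ q ℚ.- 1ℚ))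
    {{ℚ.pos*pos⇒pos (fromℕ q ^ᶻ z) {{positive-^ᶻ (fromℕ q) z}}
                    (fromℕ q ℚ.- 1ℚ) {{Q-1-positive}}}}

{-# OPTIONS --safe #-}

-- Let c(a) run over the codewords encoded from the M = q^k messages a.  Each
-- restriction of c to coordinates is a homomorphism, all of whose nonempty
-- fibres have the size of its kernel.  Hence exactly M/q messages vanish at a
-- given coordinate and at least M/q² vanish at two given coordinates, which
-- gives the sum S of the weights exactly and bounds the sum T of their squares
-- from below.  Conversely the nonzero weights W lie in [d, w], so summing
-- (w - W)(W - d) ≥ 0 over the nonzero messages bounds T from above, by
-- 4(M - 1)T ≤ 4S² + (M - 1)²(w - d)².  Comparing the two bounds yields the claim.
module Submission where

import Data.Integer.Base as ℤ
import Data.Integer.Properties as ℤ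
import Data.Nat.Base as ℕ
import Data.Nat.Properties as ℕ
open import Data.Nat.Base using (ℕ; zero; suc)
open import Data.Product.Base using (∃; _×_; _,_; proj₁; proj₂)
open import Function.Base using (_∘_)
open import Relation.Binary.PropositionalEquality as ≡ using (_≡_; refl; cong; cong₂)

-- Sums over enumerated setoids and fibres of group homomorphisms.

module EnumeratedGroups where

  open import Algebra.Bundles using (Group)
  import Algebra.Properties.Group as GroupProperties
  import Algebra.Properties.Semiring.Sum as SemiringSum
  open import Data.Fin.Base using (Fin; zero; suc; funToFin; finToFun; combine)
  import Data.Fin.Properties as Fin
  open import Data.Nat.Base hiding (ℕ; zero; suc)
  open import Data.Nat.Properties hiding (_≟_)
  import Data.Vec.Functional.Relation.Binary.Pointwise.Properties as VecPointwise
  open import Function.Bundles using (Inverse; mk↔ₛ′)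
  open import Function.Properties.Inverse using (Inverse⇒Injection)
  open import Level using (Level)
  open import Relation.Binary.Bundles using (Setoid)
  open import Relation.Binary.Definitions using (Decidable)
  open import Relation.Binary.PropositionalEquality using (sym; trans; _≗_)
  open import Relation.Nullary.Decidable using (Dec; yes; no; via-injection)
  open import Relation.Nullary.Negation using (¬_; contradiction)

  open SemiringSum +-*-semiring using (sum; sum-cong-≗; ∑-comm; sum-permute)

  private
    variable
      a p ℓ : Level
      P P′ : Set p
      n : ℕ

  χ : Dec P → ℕ
  χ (yes _) = 1
  χ (no  _) = 0

  χ-mono : (P? : Dec P) (P′? : Dec P′) → (P → P′) → χ P? ≤ χ P′?
  χ-mono (no  _) _        f = z≤n
  χ-mono (yes p) (yes _)  f = s≤s z≤n
  χ-mono (yes p) (no ¬p′) f = contradiction (f p) ¬p′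

  χ-cong : (P? : Dec P) (P′? : Dec P′) → (P → P′) → (P′ → P) → χ P? ≡ χ P′?
  χ-cong P? P′? f g = ≤-antisym (χ-mono P? P′? f) (χ-mono P′? P? g)

  χ-false : (P? : Dec P) → ¬ P → χ P? ≡ 0
  χ-false (yes p) ¬p = contradiction p ¬p
  χ-false (no  _) _  = refl

  -- `R` need only be equivalent to `P × Q`: it will be the vanishing of a restricted codeword, and
  -- the choice `P = Q = R` makes indicators idempotent.
  χ-* : {P Q R : Set p} (P? : Dec P) (Q? : Dec Q) (R? : Dec R) →
        (P → Q → R) → (R → P × Q) → χ P? * χ Q? ≡ χ R?
  χ-* (yes p) Q? R? f g = trans (*-identityˡ (χ Q?)) (χ-cong Q? R? (f p) (proj₂ ∘ g))
  χ-* (no ¬p) Q? R? f g = sym (χ-false R? (¬p ∘ proj₁ ∘ g))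

  sum-mono-≤ : ∀ {n} {f g : Fin n → ℕ} → (∀ i → f i ≤ g i) → sum f ≤ sum g
  sum-mono-≤ {zero}  f≤g = z≤n
  sum-mono-≤ {suc n} f≤g = +-mono-≤ (f≤g zero) (sum-mono-≤ (f≤g ∘ suc))

  sum-const : ∀ n x → sum {n} (λ _ → x) ≡ n * x
  sum-const zero    x = refl
  sum-const (suc n) x = cong (x +_) (sum-const n x)

  sum-χ≡ : ∀ (i : Fin n) → sum (λ j → χ (i Fin.≟ j)) ≡ 1
  sum-χ≡ {suc n} zero    = cong suc (trans (sum-const n 0) (*-zeroʳ n))
  sum-χ≡ {suc n} (suc i) = trans
    (sum-cong-≗ λ j → χ-cong (suc i Fin.≟ suc j) (i Fin.≟ j) Fin.suc-injective (cong suc))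
    (sum-χ≡ i)

  -- Stands in for function extensionality, since words are compared only pointwise.
  funToFin-cong : ∀ {m n} {f g : Fin m → Fin n} → f ≗ g → funToFin f ≡ funToFin g
  funToFin-cong {zero}  f≗g = refl
  funToFin-cong {suc m} f≗g = cong₂ combine (f≗g zero) (funToFin-cong (f≗g ∘ suc))

  Enumeration : Setoid a ℓ → ℕ → Set _
  Enumeration S N = Inverse S (≡.setoid (Fin N))

  power-enumeration : ∀ {S : Setoid a ℓ} {N} → Enumeration S N →
                      ∀ k → Enumeration (VecPointwise.setoid S k) (N ^ k)
  power-enumeration {S = S} {N} E k = record
    { to        = to′
    ; from      = from′
    ; to-cong   = to′-cong
    ; from-cong = λ { refl i → S.refl }
    ; inverse   = (λ {t} {v} v≈ → trans (to′-cong v≈)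
                    (trans (funToFin-cong {k} λ i → E.inverseˡ S.refl)
                      (Fin.funToFin-finToFin {k} {N} t)))
                , (λ { {v} refl i → E.inverseʳ (Fin.finToFun-funToFin (E.to ∘ v) i) })
    }
    where
    module S = Setoid S
    module E = Inverse E
    to′ : (Fin k → S.Carrier) → Fin (N ^ k)
    to′ v = funToFin (E.to ∘ v)
    from′ : Fin (N ^ k) → (Fin k → S.Carrier)
    from′ t = E.from ∘ finToFun t
    to′-cong : ∀ {u v} → (∀ i → u i S.≈ v i) → to′ u ≡ to′ v
    to′-cong u≈v = funToFin-cong {k} (E.to-cong ∘ u≈v)

  module Enumerated {S : Setoid a ℓ} {N} (E : Enumeration S N) where
    open Setoid S using (Carrier; _≈_) renaming (refl to ≈-refl; sym to ≈-sym)
    open Inverse E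

    ∑ : (Carrier → ℕ) → ℕ
    ∑ f = sum (f ∘ from)

    infix 4 _≈?_
    _≈?_ : Decidable _≈_
    _≈?_ = via-injection (Inverse⇒Injection E) Fin._≟_

    ∑-χ≈ : ∀ x → ∑ (λ y → χ (x ≈? y)) ≡ 1
    ∑-χ≈ x = trans
      (sum-cong-≗ λ t → χ-cong (x ≈? from t) (to x Fin.≟ t)
        (λ x≈ → trans (to-cong x≈) (inverseˡ ≈-refl)) (λ { refl → ≈-sym (inverseʳ refl) }))
      (sum-χ≡ (to x))

    -- Conjugating `π` by the enumeration gives a permutation of `Fin N`. Congruence of `f` is what
    -- lets `from (to x)` be replaced by `x`.
    ∑-rearrange : ∀ {f} → (∀ {x y} → x ≈ y → f x ≡ f y) → (π : Inverse S S) →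
                  ∑ f ≡ ∑ (f ∘ Inverse.to π)
    ∑-rearrange {f} f-cong π = trans
      (sum-permute (f ∘ from) (mk↔ₛ′ ρ ρ⁻¹ ρρ⁻¹ ρ⁻¹ρ))
      (sum-cong-≗ {N} λ t → f-cong (inverseʳ refl))
      where
      module π = Inverse π
      ρ ρ⁻¹ : Fin N → Fin N
      ρ   t = to (π.to   (from t))
      ρ⁻¹ t = to (π.from (from t))
      ρρ⁻¹ : ∀ t → ρ (ρ⁻¹ t) ≡ t
      ρρ⁻¹ t = trans (to-cong (π.inverseˡ (inverseʳ refl))) (inverseˡ ≈-refl)
      ρ⁻¹ρ : ∀ t → ρ⁻¹ (ρ t) ≡ t
      ρ⁻¹ρ t = trans (to-cong (π.inverseʳ (inverseʳ refl))) (inverseˡ ≈-refl)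

  -- Fibre sizes of a homomorphism between enumerated groups.

  module _ {c₁ ℓ₁ c₂ ℓ₂} (G : Group c₁ ℓ₁) (H : Group c₂ ℓ₂) where
    private
      module G = Group G
      module H = Group H

    rightTranslation : G.Carrier → Inverse G.setoid G.setoid
    rightTranslation g = record
      { to        = G._∙ g
      ; from      = G._// g
      ; to-cong   = G.∙-congʳ
      ; from-cong = G.∙-congʳ
      ; inverse   = (λ {x} {y} y≈ → G.trans (G.∙-congʳ y≈) (//-rightDividesˡ g x))
                  , (λ {x} {y} y≈ → G.trans (G.∙-congʳ y≈) (//-rightDividesʳ g x))
      }
      where open GroupProperties G

    module Fibres
      {|G| |H|} (EG : Enumeration G.setoid |G|) (EH : Enumeration H.setoid |H|)
      {φ : G.Carrier → H.Carrier}
      (φ-cong : ∀ {x y} → x G.≈ y → φ x H.≈ φ y)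
      (φ-homo : ∀ x y → φ (x G.∙ y) H.≈ φ x H.∙ φ y)
      where

      module EG = Enumerated EG
      module EH = Enumerated EH

      fibre : H.Carrier → ℕ
      fibre h = EG.∑ (λ g → χ (φ g EH.≈? h))

      -- Translation by `g₀` carries the kernel onto the fibre: `φ (g ∙ g₀)` is `φ g ∙ h`, which is
      -- `h` exactly when `φ g` is the identity.
      fibre-image : ∀ g₀ {h} → φ g₀ H.≈ h → fibre h ≡ fibre H.ε
      fibre-image g₀ {h} φg₀≈h = trans
        (EG.∑-rearrange {λ g → χ (φ g EH.≈? h)}
          (λ x≈y → χ-cong (φ _ EH.≈? h) (φ _ EH.≈? h)
            (H.trans (H.sym (φ-cong x≈y))) (H.trans (φ-cong x≈y)))
          (rightTranslation g₀))
        (sum-cong-≗ {|G|} λ t → let g = Inverse.from EG t in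
          χ-cong (φ (g G.∙ g₀) EH.≈? h) (φ g EH.≈? H.ε)
            (λ φgg₀≈h → identityˡ-unique (φ g) h
              (H.trans (H.∙-congˡ (H.sym φg₀≈h)) (H.trans (H.sym (φ-homo g g₀)) φgg₀≈h)))
            (λ φg≈ε → H.trans (φ-homo g g₀)
              (H.trans (H.∙-cong φg≈ε φg₀≈h) (H.identityˡ h))))
        where open GroupProperties H

      -- A fibre is either empty or a translate of the kernel, and a search through the enumeration
      -- decides which.
      fibre-≤ : ∀ h → fibre h ≤ fibre H.ε
      fibre-≤ h with Fin.any? (λ t → φ (Inverse.from EG t) EH.≈? h)
      ... | yes (t , φg≈h) = ≤-reflexive (fibre-image _ φg≈h)
      ... | no  h∉im       = ≤-trans (≤-reflexive (trans
              (sum-cong-≗ {|G|} λ t → χ-false (φ (Inverse.from EG t) EH.≈? h) (λ φg≈h → h∉im (t , φg≈h)))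
              (trans (sum-const |G| 0) (*-zeroʳ |G|)))) z≤n

      -- Double counting: each `g` lies in exactly one fibre.
      ∑-fibre : EH.∑ fibre ≡ |G|
      ∑-fibre = trans (∑-comm {|H|} {|G|} _) (trans (sum-cong-≗ {|G|} λ t → EH.∑-χ≈ _)
        (trans (sum-const |G| 1) (*-identityʳ |G|)))

      -- Only an inequality, because fibres outside the image are empty.
      order-≤ : |G| ≤ |H| * fibre H.ε
      order-≤ = ≤-trans (≤-reflexive (sym ∑-fibre))
        (≤-trans (sum-mono-≤ (fibre-≤ ∘ Inverse.from EH)) (≤-reflexive (sum-const |H| _)))

      order-≡ : (∀ h → ∃ λ g → φ g H.≈ h) → |G| ≡ |H| * fibre H.ε
      order-≡ φ-surjective = trans (sym ∑-fibre) (trans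
        (sum-cong-≗ {|H|} λ t → let (g , φg≈h) = φ-surjective (Inverse.from EH t) in fibre-image g φg≈h)
        (sum-const |H| _))

-- First and second moments of the zero counts and weights.

module WeightMoments where

  open import Defs hiding (_^_)
  open EnumeratedGroups
  open import Algebra.Apartness.Bundles using (HeytingField)
  open import Algebra.Bundles using (Group)
  import Algebra.Construct.Pointwise as Pointwise
  import Algebra.Properties.CommutativeMonoid.Sum as CommutativeMonoidSum
  import Algebra.Properties.Group as GroupProperties
  import Algebra.Properties.Semiring.Sum as SemiringSum
  open import Data.Empty using (⊥-elim)
  open import Data.Fin.Base using (Fin; zero; suc)
  import Data.Fin.Properties as Fin
  open import Data.Nat.Base hiding (ℕ; zero; suc)
  open import Data.Nat.Properties hiding (_≟_)
  open import Data.Nat.Tactic.RingSolver using (solve-∀)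
  open import Data.Vec.Base using (count; tabulate)
  open import Data.Vec.Functional using (Vector; []; _∷_)
  open import Function.Bundles using (Inverse)
  open import Relation.Nullary.Decidable using (Dec; yes; no; ¬?)
  open import Relation.Nullary.Negation using (¬_; contradiction)
  open import Relation.Unary using (Pred; _∈_)
  import Relation.Unary as Unary

  open SemiringSum +-*-semiring
    using (sum; sum-cong-≗; ∑-distrib-+; ∑-comm; *-distribˡ-sum; *-distribʳ-sum)

  count-tabulate : ∀ {a p} {A : Set a} {P : Pred A p} (P? : Unary.Decidable P) {n} (v : Vector A n) →
                   count P? (tabulate v) ≡ sum (λ i → χ (P? (v i)))
  count-tabulate P? {zero}  v = refl
  count-tabulate P? {suc n} v with P? (v zero)
  ... | yes _ = cong suc (count-tabulate P? (v ∘ suc))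
  ... | no  _ = count-tabulate P? (v ∘ suc)

  χ-complement : ∀ {p} {P : Set p} (P? : Dec P) → χ (¬? P?) + χ P? ≡ 1
  χ-complement (yes _) = refl
  χ-complement (no  _) = refl

  -- With `x = d + s` and `w = x + t` the two sides differ by exactly `s * t`.
  [w-x][x-d]≥0 : ∀ {d x w} → d ≤ x → x ≤ w → x * x + d * w ≤ (w + d) * x
  [w-x][x-d]≥0 {d} {x} d≤x x≤w with m≤n⇒∃[o]m+o≡n d≤x | m≤n⇒∃[o]m+o≡n x≤w
  ... | s , refl | t , refl = ≤-trans (m≤m+n _ (s * t)) (≤-reflexive (lemma d s t))
    where
    lemma : ∀ d s t → (d + s) * (d + s) + d * (d + s + t) + s * t ≡ (d + s + t + d) * (d + s)
    lemma = solve-∀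

  module _ {q c ℓ₁ ℓ₂} (F : FiniteField q c ℓ₁ ℓ₂) where

    open FiniteField F using (0#; _≈_; _≟_; enumeration; +-group; +-commutativeMonoid)
      renaming (_*_ to _*ᶠ_)
    module F = FiniteField F
    open HeytingField F.heytingField using (_#_; #⇒invertible; tight)
    open LinearCodes F
    open CommutativeMonoidSum +-commutativeMonoid using ()
      renaming (sum to sumᶠ; sum-cong-≋ to sumᶠ-cong; ∑-distrib-+ to sumᶠ-+)
    open SemiringSum F.semiring using () renaming (*-distribˡ-sum to *-distribˡ-sumᶠ)

    wordGroup : ℕ → Group c ℓ₁
    wordGroup n = record { isGroup = Pointwise.isGroup (Fin n) (Group.isGroup +-group) }

    wordEnumeration : ∀ n → Enumeration (Group.setoid (wordGroup n)) (q ^ n)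
    wordEnumeration n = power-enumeration enumeration n

    module Words n = Enumerated (wordEnumeration n)

    -- The field axioms invert elements apart from zero, while here `x` is only known to be unequal
    -- to zero. If an exhaustive search finds no inverse, `x` cannot be apart from zero, and
    -- tightness gives `x ≈ 0#`.
    inverse : ∀ {x} → ¬ (x ≈ 0#) → ∃ λ y → y *ᶠ x ≈ F.1#
    inverse {x} x≉0 with Fin.any? (λ t → (Inverse.from enumeration t *ᶠ x) ≟ F.1#)
    ... | yes (t , tx≈1) = Inverse.from enumeration t , tx≈1
    ... | no  ∄x⁻¹       = contradiction (proj₁ (tight x 0#) ¬x#0) x≉0
      where
      open Inverse enumeration
      open GroupProperties +-group using (ε⁻¹≈ε)
      x-0≈x : x F.- 0# ≈ x
      x-0≈x = F.trans (F.+-congˡ ε⁻¹≈ε) (F.+-identityʳ x)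
      ¬x#0 : ¬ (x # 0#)
      ¬x#0 x#0 with #⇒invertible x#0
      ... | y , y[x-0]≈1 , _ = ∄x⁻¹ (to y ,
        F.trans (F.*-cong (inverseʳ refl) (F.sym x-0≈x)) y[x-0]≈1)

    -- Zeros are counted before weights because vanishing at given coordinates is a kernel
    -- condition.
    zeros : ∀ {n} → Word n → ℕ
    zeros v = sum (λ i → χ (v i ≟ 0#))

    ω+zeros : ∀ {n} (v : Word n) → ω v + zeros v ≡ n
    ω+zeros {n} v = begin
      ω v + zeros v
        ≡⟨ cong (_+ zeros v) (count-tabulate (λ x → ¬? (x ≟ 0#)) v) ⟩
      sum (λ i → χ (¬? (v i ≟ 0#))) + zeros v
        ≡⟨ ∑-distrib-+ {n} _ _ ⟨
      sum (λ i → χ (¬? (v i ≟ 0#)) + χ (v i ≟ 0#))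
        ≡⟨ sum-cong-≗ {n} (λ i → χ-complement (v i ≟ 0#)) ⟩
      sum {n} (λ _ → 1)
        ≡⟨ sum-const n 1 ⟩
      n * 1
        ≡⟨ *-identityʳ n ⟩
      n                                                  ∎
      where open ≡.≡-Reasoning

    -- Counting messages by the zeros of their codewords.

    module _ {n k} (b : Vector (Word n) k) where

      encode : Word k → Word n
      encode a = linearCombination a b

      encode-cong : ∀ {a a′} → a ≋ a′ → encode a ≋ encode a′
      encode-cong a≋a′ i = sumᶠ-cong {k} (λ j → F.*-congʳ (a≋a′ j))

      encode-+ : ∀ a a′ → encode (a +ᵂ a′) ≋ (encode a +ᵂ encode a′)
      encode-+ a a′ i = F.trans (sumᶠ-cong {k} (λ j → F.distribʳ (b j i) (a j) (a′ j))) (sumᶠ-+ {k} _ _)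

      encode-* : ∀ x a → encode (x *ᵂ a) ≋ (x *ᵂ encode a)
      encode-* x a i = F.trans (sumᶠ-cong {k} (λ j → F.*-assoc x (a j) (b j i)))
        (F.sym (*-distribˡ-sumᶠ {k} x _))

      module Restricted {m} (ι : Fin m → Fin n) =
        Fibres (wordGroup k) (wordGroup m) (wordEnumeration k) (wordEnumeration m)
          {λ a → encode a ∘ ι} (λ a≋a′ → encode-cong a≋a′ ∘ ι) (λ a a′ → encode-+ a a′ ∘ ι)

      open Words k using (∑; _≈?_)

      ∑-cong : ∀ {f g} → (∀ a → f a ≡ g a) → ∑ f ≡ ∑ g
      ∑-cong f≗g = sum-cong-≗ {q ^ k} (λ t → f≗g _)

      ζ : Word k → Fin n → ℕ
      ζ a i = χ (encode a i ≟ 0#)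

      -- On the diagonal this counts the messages vanishing at one coordinate, as indicators are
      -- idempotent.
      commonZeros : Fin n → Fin n → ℕ
      commonZeros i j = ∑ (λ a → ζ a i * ζ a j)

      -- The messages counted form the kernel of the restriction to the pair `i`, `j`, a map into a
      -- group of `q ^ 2` elements. It need not be onto, for instance when `i` and `j` coincide.
      q^k≤q²*commonZeros : ∀ i j → q ^ k ≤ q * q * commonZeros i j
      q^k≤q²*commonZeros i j = begin
        q ^ k                      ≤⟨ R.order-≤ ⟩
        q ^ 2 * R.fibre 0ᵂ         ≡⟨ cong₂ _*_ (cong (q *_) (*-identityʳ q)) (∑-cong λ a → ≡.sym
                                        (χ-* (encode a i ≟ 0#) (encode a j ≟ 0#) (encode a ∘ ι R.EH.≈? 0ᵂ)
                                          (λ { z₁ z₂ zero → z₁ ; z₁ z₂ (suc zero) → z₂ })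
                                          (λ z → z zero , z (suc zero)))) ⟩
        q * q * commonZeros i j    ∎
        where
        open ≤-Reasoning
        ι : Fin 2 → Fin n
        ι = i ∷ j ∷ []
        module R = Restricted ι

      -- Each square expands into a double sum over pairs of coordinates, and the sum over messages
      -- moves inside.
      ∑zeros² : ∑ (λ a → zeros (encode a) * zeros (encode a)) ≡ sum (λ i → sum (commonZeros i))
      ∑zeros² = begin
        ∑ (λ a → zeros (encode a) * zeros (encode a))
          ≡⟨ ∑-cong (λ a → ≡.trans (*-distribʳ-sum {n} (zeros (encode a)) (ζ a))
               (sum-cong-≗ {n} λ i → *-distribˡ-sum {n} (ζ a i) (ζ a))) ⟩
        ∑ (λ a → sum λ i → sum λ j → ζ a i * ζ a j)
          ≡⟨ ∑-comm {q ^ k} {n} _ ⟩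
        sum (λ i → ∑ λ a → sum λ j → ζ a i * ζ a j)
          ≡⟨ sum-cong-≗ {n} (λ i → ∑-comm {q ^ k} {n} _) ⟩
        sum (λ i → sum (commonZeros i)) ∎
        where open ≡.≡-Reasoning

      module _ (nondegenerate : ∀ i → ∃ λ a → ¬ (encode a i ≈ 0#)) where

        -- By nondegeneracy the restriction to one coordinate is onto a group of `q` elements, so
        -- its kernel has the exact size.
        q*commonZeros : ∀ i → q * commonZeros i i ≡ q ^ k
        q*commonZeros i = begin
          q * commonZeros i i        ≡⟨ cong₂ _*_ (≡.sym (*-identityʳ q)) (∑-cong λ a →
                                        (χ-* (encode a i ≟ 0#) (encode a i ≟ 0#) (encode a ∘ ι R.EH.≈? 0ᵂ)
                                          (λ { z₁ z₂ zero → z₁ }) (λ z → z zero , z zero))) ⟩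
          q ^ 1 * R.fibre 0ᵂ         ≡⟨ R.order-≡ surjective ⟨
          q ^ k ∎
          where
          open ≡.≡-Reasoning
          ι : Fin 1 → Fin n
          ι = i ∷ []
          module R = Restricted ι
          surjective : ∀ (h : Word 1) → ∃ λ a → (encode a ∘ ι) ≋ h
          surjective h with nondegenerate i
          ... | a , x≉0 with inverse x≉0
          -- Scaling by `y` normalises the nonzero value at `i` to one; the further factor `h zero`
          -- reaches the target.
          ... | y , yx≈1 = (h zero *ᶠ y) *ᵂ a , λ { zero → F.trans (encode-* _ a i)
                (F.trans (F.*-assoc _ _ _) (F.trans (F.*-congˡ yx≈1) (F.*-identityʳ _))) }

        q*∑zeros : q * ∑ (zeros ∘ encode) ≡ n * q ^ k
        q*∑zeros = begin
          q * ∑ (zeros ∘ encode)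
            ≡⟨ cong (q *_) (∑-comm {q ^ k} {n} _) ⟩
          q * sum (λ i → ∑ (λ a → ζ a i))
            ≡⟨ *-distribˡ-sum {n} q _ ⟩
          sum (λ i → q * ∑ (λ a → ζ a i))
            ≡⟨ sum-cong-≗ {n} (λ i → ≡.trans
              (cong (q *_) (∑-cong λ a → let z? = encode a i ≟ 0# in
                 ≡.sym (χ-* z? z? z? (λ z _ → z) (λ z → z , z))))
              (q*commonZeros i)) ⟩
          sum {n} (λ _ → q ^ k)
            ≡⟨ sum-const n (q ^ k) ⟩
          n * q ^ k                                         ∎
          where open ≡.≡-Reasoning

        -- One formula for both cases. Off the diagonal the indicator terms vanish and the general
        -- bound remains; on it `q * q * commonZeros i i` equals `q * q ^ k`, so equality holds.
        commonZeros-≥ : ∀ i j → q ^ k + χ (i Fin.≟ j) * (q * q ^ k) ≤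
                                  q * q * commonZeros i j + χ (i Fin.≟ j) * q ^ k
        commonZeros-≥ i j with i Fin.≟ j
        ... | no  _    = +-monoˡ-≤ 0 (q^k≤q²*commonZeros i j)
        ... | yes refl = ≤-reflexive (≡.sym (≡.trans (cong (_+ 1 * q ^ k)
                (≡.trans (*-assoc q q _) (cong (q *_) (q*commonZeros i)))) (lemma (q ^ k) (q * q ^ k))))
          where
          lemma : ∀ x y → y + 1 * x ≡ x + 1 * y
          lemma = solve-∀

        -- Summing `commonZeros-≥` over all pairs: the indicator terms contribute once for each of
        -- the `n` diagonal pairs.
        ∑zeros²-≥ : n * n * q ^ k + n * q * q ^ k ≤
                    q * q * ∑ (λ a → zeros (encode a) * zeros (encode a)) + n * q ^ k
        ∑zeros²-≥ = begin
          n * n * M + n * q * M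
            ≡⟨ lemma n q M ⟩
          n * (n * M + 1 * (q * M))
            ≡⟨ sum-const n (n * M + 1 * (q * M)) ⟨
          sum {n} (λ i → n * M + 1 * (q * M))
            ≡⟨ sum-cong-≗ {n} (λ i → sum-+-diagonal (λ _ → M) (q * M) i (sum-const n M)) ⟨
          sum {n} (λ i → sum λ j → M + χ (i Fin.≟ j) * (q * M))
            ≤⟨ sum-mono-≤ {n} (λ i → sum-mono-≤ {n} (commonZeros-≥ i)) ⟩
          sum (λ i → sum λ j → q * q * commonZeros i j + χ (i Fin.≟ j) * M)
            ≡⟨ sum-cong-≗ {n} (λ i → sum-+-diagonal (λ j → q * q * commonZeros i j) M i
                 (≡.sym (*-distribˡ-sum {n} (q * q) (commonZeros i)))) ⟩
          sum (λ i → q * q * sum (commonZeros i) + 1 * M)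
            ≡⟨ ∑-distrib-+ {n} _ _ ⟩
          sum (λ i → q * q * sum (commonZeros i)) + sum {n} (λ i → 1 * M)
            ≡⟨ cong₂ _+_ (≡.sym (*-distribˡ-sum {n} (q * q) _))
                 (≡.trans (sum-const n (1 * M)) (cong (n *_) (*-identityˡ M))) ⟩
          q * q * sum (λ i → sum (commonZeros i)) + n * M
            ≡⟨ cong (λ x → q * q * x + n * M) ∑zeros² ⟨
          q * q * ∑ (λ a → zeros (encode a) * zeros (encode a)) + n * M ∎
          where
          open ≤-Reasoning
          M : ℕ
          M = q ^ k
          lemma : ∀ n q M → n * n * M + n * q * M ≡ n * (n * M + 1 * (q * M))
          lemma = solve-∀
          sum-+-diagonal : ∀ f x (i : Fin n) {s} → sum f ≡ s →
                           sum (λ j → f j + χ (i Fin.≟ j) * x) ≡ s + 1 * x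
          sum-+-diagonal f x i Σf≡s = ≡.trans (∑-distrib-+ {n} f _) (cong₂ _+_ Σf≡s
            (≡.trans (≡.sym (*-distribʳ-sum {n} x _)) (cong (_* x) (sum-χ≡ i))))

      ∑ω+∑zeros : ∑ (ω ∘ encode) + ∑ (zeros ∘ encode) ≡ n * q ^ k
      ∑ω+∑zeros = ≡.trans (≡.sym (∑-distrib-+ {q ^ k} _ _)) (≡.trans (∑-cong λ a → ω+zeros (encode a))
        (≡.trans (sum-const (q ^ k) n) (*-comm (q ^ k) n)))

      -- This sums `W² = (n - Y)²` for weight `W` and zero count `Y`, rearranged to avoid
      -- subtraction in ℕ.
      ∑ω²+2n∑zeros : ∑ (λ a → ω (encode a) * ω (encode a)) + 2 * n * ∑ (zeros ∘ encode) ≡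
                     n * n * q ^ k + ∑ (λ a → zeros (encode a) * zeros (encode a))
      ∑ω²+2n∑zeros = begin
        ∑ W² + 2 * n * ∑ Y
          ≡⟨ cong (∑ W² +_) (*-distribˡ-sum {q ^ k} (2 * n) _) ⟩
        ∑ W² + ∑ (λ a → 2 * n * Y a)
          ≡⟨ ∑-distrib-+ {q ^ k} _ _ ⟨
        ∑ (λ a → W a * W a + 2 * n * Y a)
          ≡⟨ ∑-cong (λ a → lemma (W a) (Y a) (ω+zeros (encode a))) ⟩
        ∑ (λ a → n * n + Y a * Y a)
          ≡⟨ ∑-distrib-+ {q ^ k} _ _ ⟩
        ∑ (λ _ → n * n) + ∑ Y²
          ≡⟨ cong (_+ ∑ Y²) (≡.trans (sum-const (q ^ k) _) (*-comm (q ^ k) _)) ⟩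
        n * n * q ^ k + ∑ Y²        ∎
        where
        open ≡.≡-Reasoning
        W Y W² Y² : Word k → ℕ
        W    = ω ∘ encode
        Y    = zeros ∘ encode
        W² a = W a * W a
        Y² a = Y a * Y a
        identity : ∀ x y → x * x + 2 * (x + y) * y ≡ (x + y) * (x + y) + y * y
        identity = solve-∀
        lemma : ∀ x y {n} → x + y ≡ n → x * x + 2 * n * y ≡ n * n + y * y
        lemma x y refl = identity x y

      -- The summed inequality `(w - W)(W - d) ≥ 0` without subtraction. The zero message would
      -- contribute `- d * w`, which the last term on the right offsets.
      ∑ω²-≤ : ∀ {d w} → (∀ a → ω (encode a) ≤ w) → (∀ {a} → ¬ (0ᵂ ≋ a) → d ≤ ω (encode a)) →
              ∑ (λ a → ω (encode a) * ω (encode a)) + d * w * q ^ k ≤ (w + d) * ∑ (ω ∘ encode) + d * w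
      ∑ω²-≤ {d} {w} ω≤w d≤ω = begin
        ∑ W² + d * w * q ^ k
          ≡⟨ cong (∑ W² +_) (≡.trans (*-comm (d * w) _) (≡.sym (sum-const (q ^ k) _))) ⟩
        ∑ W² + ∑ (λ _ → d * w)
          ≡⟨ ∑-distrib-+ {q ^ k} _ _ ⟨
        ∑ (λ a → W a * W a + d * w)
          ≤⟨ sum-mono-≤ {q ^ k} (λ t → pointwise _) ⟩
        ∑ (λ a → (w + d) * W a + d * w * χ (0ᵂ ≈? a))
          ≡⟨ ∑-distrib-+ {q ^ k} _ _ ⟩
        ∑ (λ a → (w + d) * W a) + ∑ (λ a → d * w * χ (0ᵂ ≈? a))
          ≡⟨ cong₂ _+_ (*-distribˡ-sum {q ^ k} (w + d) _) (*-distribˡ-sum {q ^ k} (d * w) _) ⟨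
        (w + d) * ∑ W + d * w * ∑ (λ a → χ (0ᵂ ≈? a))
          ≡⟨ cong ((w + d) * ∑ W +_) (≡.trans (cong (d * w *_) (Words.∑-χ≈ k 0ᵂ)) (*-identityʳ (d * w))) ⟩
        (w + d) * ∑ W + d * w ∎
        where
        open ≤-Reasoning
        W W² : Word k → ℕ
        W    = ω ∘ encode
        W² a = W a * W a
        -- The zero message need not satisfy d ≤ W; the last term compensates for it.
        pointwise : ∀ a → W a * W a + d * w ≤ (w + d) * W a + d * w * χ (0ᵂ ≈? a)
        pointwise a with 0ᵂ ≈? a
        ... | yes _  = +-mono-≤ (*-monoˡ-≤ (W a) (≤-trans (ω≤w a) (m≤m+n w d)))
                         (≤-reflexive (≡.sym (*-identityʳ (d * w))))
        ... | no 0≉a = ≤-trans ([w-x][x-d]≥0 (d≤ω 0≉a) (ω≤w a)) (m≤m+n _ _)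

    -- From codes and bases to the encoding map.

    module _ {ℓ n} {C : Pred (Word n) ℓ} (isSubspace : IsSubspace C) where
      open IsSubspace isSubspace

      encode-closed : ∀ {k} (b : Vector (Word n) k) → (∀ j → b j ∈ C) → ∀ a → encode b a ∈ C
      encode-closed {zero}  b b∈C a = 0ᵂ-closed
      encode-closed {suc k} b b∈C a = +ᵂ-closed (*ᵂ-closed (a zero) (b∈C zero))
        (encode-closed (b ∘ suc) (b∈C ∘ suc) (a ∘ suc))

    module _ {ℓ n k} {C : Pred (Word n) ℓ} {b : Vector (Word n) k} (isBasis : IsBasis C b) where
      open IsBasis isBasis

      -- Nondegeneracy is a negated existential, so the witness comes from a search over all
      -- messages. If the search fails, `spanning` makes coordinate `i` vanish on the whole code.
      basis-nondegenerate : Nondegenerate C → ∀ i → ∃ λ a → ¬ (encode b a i ≈ 0#)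
      basis-nondegenerate nondegenerate i
        with Fin.any? (λ t → ¬? (encode b (Inverse.from (wordEnumeration k) t) i ≟ 0#))
      ... | yes (t , ≉0) = _ , ≉0
      ... | no  ∄t       = ⊥-elim (nondegenerate (i , vanishes))
        where
        open Inverse (wordEnumeration k)
        vanishes : ∀ {v} → v ∈ C → v i ≈ 0#
        vanishes {v} v∈C with spanning v∈C | v i ≟ 0#
        ... | _            | yes vᵢ≈0 = vᵢ≈0
        ... | a , v≋encode | no  vᵢ≉0 = contradiction
          (to a , λ encode≈0 → vᵢ≉0 (F.trans (v≋encode i)
             (F.trans (encode-cong b (λ j → F.sym (inverseʳ refl j)) i) encode≈0))) ∄t

-- Transfer to the rationals and comparison of the moment bounds.

module RationalInequalities where

  open import Defs
  open import Data.Integer.Base using (+_) renaming (_-_ to _-ᶻ_)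
  open import Data.Rational.Base
  open import Data.Rational.Properties
  open import Data.Rational.Solver using (module +-*-Solver)
  import Data.Rational.Unnormalised.Base as ℚᵘ
  import Data.Rational.Unnormalised.Properties as ℚᵘ
  open import Data.Sum.Base using (inj₁; inj₂)
  open import Relation.Binary.PropositionalEquality using (sym; trans)

  -- `fromℕ` normalises its fraction; its arithmetic laws are therefore checked on unnormalised
  -- rationals, where the value is `m` over 1.
  toℚᵘ-fromℕ : ∀ m → toℚᵘ (fromℕ m) ℚᵘ.≃ ℚᵘ.mkℚᵘ (+ m) 0
  toℚᵘ-fromℕ m = toℚᵘ-fromℚᵘ (ℚᵘ.mkℚᵘ (+ m) 0)

  fromℕ-homo-+ : ∀ m n → fromℕ (m ℕ.+ n) ≡ fromℕ m + fromℕ n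
  fromℕ-homo-+ m n = toℚᵘ-injective (begin
    toℚᵘ (fromℕ (m ℕ.+ n))
      ≈⟨ toℚᵘ-fromℕ (m ℕ.+ n) ⟩
    ℚᵘ.mkℚᵘ (+ (m ℕ.+ n)) 0
      ≈⟨ ℚᵘ.*≡* (cong (ℤ._* + 1)
           (cong₂ ℤ._+_ (sym (ℤ.*-identityʳ (+ m))) (sym (ℤ.*-identityʳ (+ n))))) ⟩
    ℚᵘ.mkℚᵘ (+ m) 0 ℚᵘ.+ ℚᵘ.mkℚᵘ (+ n) 0
      ≈⟨ ℚᵘ.+-cong (toℚᵘ-fromℕ m) (toℚᵘ-fromℕ n) ⟨
    toℚᵘ (fromℕ m) ℚᵘ.+ toℚᵘ (fromℕ n)
      ≈⟨ toℚᵘ-homo-+ (fromℕ m) (fromℕ n) ⟨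
    toℚᵘ (fromℕ m + fromℕ n)                       ∎)
    where open ℚᵘ.≃-Reasoning

  fromℕ-homo-* : ∀ m n → fromℕ (m ℕ.* n) ≡ fromℕ m * fromℕ n
  fromℕ-homo-* m n = toℚᵘ-injective (begin
    toℚᵘ (fromℕ (m ℕ.* n))
      ≈⟨ toℚᵘ-fromℕ (m ℕ.* n) ⟩
    ℚᵘ.mkℚᵘ (+ (m ℕ.* n)) 0
      ≈⟨ ℚᵘ.*≡* (cong (ℤ._* + 1) (ℤ.pos-* m n)) ⟩
    ℚᵘ.mkℚᵘ (+ m) 0 ℚᵘ.* ℚᵘ.mkℚᵘ (+ n) 0
      ≈⟨ ℚᵘ.*-cong (toℚᵘ-fromℕ m) (toℚᵘ-fromℕ n) ⟨
    toℚᵘ (fromℕ m) ℚᵘ.* toℚᵘ (fromℕ n)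
      ≈⟨ toℚᵘ-homo-* (fromℕ m) (fromℕ n) ⟨
    toℚᵘ (fromℕ m * fromℕ n)                       ∎)
    where open ℚᵘ.≃-Reasoning

  fromℕ-mono-≤ : ∀ {m n} → m ℕ.≤ n → fromℕ m ≤ fromℕ n
  fromℕ-mono-≤ {m} {n} m≤n = toℚᵘ-cancel-≤
    (ℚᵘ.≤-respˡ-≃ (ℚᵘ.≃-sym (toℚᵘ-fromℕ m)) (ℚᵘ.≤-respʳ-≃ (ℚᵘ.≃-sym (toℚᵘ-fromℕ n))
      (ℚᵘ.*≤* (ℤ.*-monoʳ-≤-nonNeg (+ 1) (ℤ.+≤+ m≤n)))))

  fromℕ-mono-< : ∀ {m n} → m ℕ.< n → fromℕ m < fromℕ n
  fromℕ-mono-< {m} {n} m<n = toℚᵘ-cancel-<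
    (ℚᵘ.<-respˡ-≃ (ℚᵘ.≃-sym (toℚᵘ-fromℕ m)) (ℚᵘ.<-respʳ-≃ (ℚᵘ.≃-sym (toℚᵘ-fromℕ n))
      (ℚᵘ.*<* (ℤ.*-monoʳ-<-pos (+ 1) (ℤ.+<+ m<n)))))

  fromℕ-positive : ∀ {m} → 0 ℕ.< m → Positive (fromℕ m)
  fromℕ-positive = positive ∘ fromℕ-mono-<

  fromℕ-1-positive : ∀ {m} → 1 ℕ.< m → Positive (fromℕ m - 1ℚ)
  fromℕ-1-positive 1<m = positive (+-monoˡ-< (- 1ℚ) (fromℕ-mono-< 1<m))

  fromℕ-homo-^ : ∀ m k → fromℕ (m ℕ.^ k) ≡ fromℕ m ^ k
  fromℕ-homo-^ m zero    = refl
  fromℕ-homo-^ m (suc k) = trans (fromℕ-homo-* m (m ℕ.^ k)) (cong (fromℕ m *_) (fromℕ-homo-^ m k))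

  -- The library lemma nonPos*nonPos⇒nonPos concludes NonNegative, despite its name.
  0≤p*p : ∀ p → 0ℚ ≤ p * p
  0≤p*p p with ≤-total 0ℚ p
  ... | inj₁ 0≤p = nonNegative⁻¹ (p * p) {{nonNeg*nonNeg⇒nonNeg p {{nonNegative 0≤p}} p {{nonNegative 0≤p}}}}
  ... | inj₂ p≤0 = nonNegative⁻¹ (p * p) {{nonPos*nonPos⇒nonPos p {{nonPositive p≤0}} p {{nonPositive p≤0}}}}

  ^ᶻ[k-2]*p*p : ∀ p .{{_ : NonZero p}} {k} → 1 ℕ.≤ k → p ^ᶻ (+ k -ᶻ + 2) * (p * p) ≡ p ^ k
  ^ᶻ[k-2]*p*p p {suc zero}    _ = begin
    -- For `k = 1` the exponent computes to -1, so the power unfolds to `1/ p * 1ℚ`.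
    1/ p * 1ℚ * (p * p)
      ≡⟨ solve 2 (λ x y → x :* con 1ℚ :* (y :* y) := x :* y :* (y :* con 1ℚ)) refl (1/ p) p ⟩
    1/ p * p * (p * 1ℚ)
      ≡⟨ cong (_* (p * 1ℚ)) (*-inverseˡ p) ⟩
    1ℚ * (p * 1ℚ)
      ≡⟨ *-identityˡ (p * 1ℚ) ⟩
    p * 1ℚ              ∎
    where open ≡.≡-Reasoning
          open +-*-Solver
  ^ᶻ[k-2]*p*p p {suc (suc k)} _ = solve 2 (λ x y → y :* (x :* x) := x :* (x :* y)) refl p (p ^ k)
    where open +-*-Solver

  -- The slack of the conclusion is 4m times that of the hypothesis plus the
  -- square of 2S − m(w + d).
  4mT≤4S²+m²[w-d]² : ∀ m .{{_ : NonNegative m}} {S T w d} → T + d * w * m ≤ (w + d) * S →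
    fromℕ 4 * m * T ≤ fromℕ 4 * (S * S) + m * m * ((w - d) * (w - d))
  4mT≤4S²+m²[w-d]² m {S} {T} {w} {d} T≤ = begin
    4ℚ * m * T
      ≡⟨ solve 4 (λ m T w d → con 4ℚ :* m :* T
           := con 4ℚ :* m :* (T :+ d :* w :* m) :+ (:- (con 4ℚ :* m :* (d :* w :* m)) :+ con 0ℚ))
           refl m T w d ⟩
    4ℚ * m * (T + d * w * m) + (- (4ℚ * m * (d * w * m)) + 0ℚ)
      ≤⟨ +-mono-≤ (*-monoˡ-≤-nonNeg (4ℚ * m) {{nonNeg*nonNeg⇒nonNeg 4ℚ m}} T≤)
           (+-monoʳ-≤ (- (4ℚ * m * (d * w * m))) (0≤p*p e)) ⟩
    4ℚ * m * ((w + d) * S) + (- (4ℚ * m * (d * w * m)) + e * e)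
      ≡⟨ solve 4 (λ m S w d → let e = con 2ℚ :* S :- m :* (w :+ d) in
           con 4ℚ :* m :* ((w :+ d) :* S) :+ (:- (con 4ℚ :* m :* (d :* w :* m)) :+ e :* e)
           := con 4ℚ :* (S :* S) :+ m :* m :* ((w :- d) :* (w :- d))) refl m S w d ⟩
    4ℚ * (S * S) + m * m * ((w - d) * (w - d)) ∎
    where
    open ≤-Reasoning
    open +-*-Solver
    2ℚ 4ℚ e : ℚ
    2ℚ = fromℕ 2
    4ℚ = fromℕ 4
    e  = 2ℚ * S - m * (w + d)

  -- The exact first moment of the weights, obtained by removing the zero counts from the total
  -- `n * M`.
  q*S≡n[q-1]M : ∀ {q n M S Y} → S + Y ≡ n * M → q * Y ≡ n * M → q * S ≡ n * (q - 1ℚ) * M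
  q*S≡n[q-1]M {q} {n} {M} {S} {Y} S+Y≡ qY≡ = begin
    q * S
      ≡⟨ solve 3 (λ q S Y → q :* S := q :* (S :+ Y) :- q :* Y) refl q S Y ⟩
    q * (S + Y) - q * Y
      ≡⟨ cong₂ (λ x y → q * x - y) S+Y≡ qY≡ ⟩
    q * (n * M) - n * M
      ≡⟨ solve 3 (λ q n M → q :* (n :* M) :- n :* M := n :* (q :- con 1ℚ) :* M) refl q n M ⟩
    n * (q - 1ℚ) * M            ∎
    where
    open ≡.≡-Reasoning
    open +-*-Solver

  -- Multiply `T = n²M + U - 2nY` by `q²`, insert the exact value of `q * Y`, and bound `q²U` from
  -- below by `U≥`.
  M[q-1]n[n[q-1]+1]≤q²T : ∀ {q n M T Y U} → q * Y ≡ n * M →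
    T + fromℕ 2 * n * Y ≡ n * n * M + U →
    n * n * M + n * q * M ≤ q * q * U + n * M →
    M * (q - 1ℚ) * n * (n * (q - 1ℚ) + 1ℚ) ≤ q * q * T
  M[q-1]n[n[q-1]+1]≤q²T {q} {n} {M} {T} {Y} {U} qY≡ T+≡ U≥ = begin
    M * (q - 1ℚ) * n * (n * (q - 1ℚ) + 1ℚ)
      ≡⟨ solve 3 (λ q n M → M :* (q :- con 1ℚ) :* n :* (n :* (q :- con 1ℚ) :+ con 1ℚ)
           := n :* n :* M :+ n :* q :* M :+ (q :* q :* (n :* n :* M) :- con 2ℚ :* n :* q :* (n :* M) :- n :* M))
           refl q n M ⟩
    n * n * M + n * q * M + rest
      ≤⟨ +-monoˡ-≤ rest U≥ ⟩
    q * q * U + n * M + rest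
      ≡⟨ solve 4 (λ q n M U → q :* q :* U :+ n :* M :+ (q :* q :* (n :* n :* M) :- con 2ℚ :* n :* q :* (n :* M) :- n :* M)
           := q :* q :* (n :* n :* M :+ U) :- con 2ℚ :* n :* q :* (n :* M)) refl q n M U ⟩
    q * q * (n * n * M + U) - 2ℚ * n * q * (n * M)
      ≡⟨ cong₂ (λ x y → q * q * x - 2ℚ * n * q * y) T+≡ qY≡ ⟨
    q * q * (T + 2ℚ * n * Y) - 2ℚ * n * q * (q * Y)
      ≡⟨ solve 4 (λ q n T Y → q :* q :* (T :+ con 2ℚ :* n :* Y) :- con 2ℚ :* n :* q :* (q :* Y)
           := q :* q :* T) refl q n T Y ⟩
    q * q * T ∎
    where
    open ≤-Reasoning
    open +-*-Solver
    2ℚ rest : ℚ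
    2ℚ = fromℕ 2
    rest = q * q * (n * n * M) - 2ℚ * n * q * (n * M) - n * M

  -- Multiplication by the common denominator `4n²mG`. In use, `m` is `q^k - 1`, `G` is
  -- `q^(k-2) (q - 1)`, `r` is `q - 1` and `e` is `w - d`.
  clear-denominators : ∀ n m G r e .{{_ : Positive n}} .{{_ : Positive m}} .{{_ : Positive G}}
    .{{_ : NonZero n}} .{{_ : NonZero m}} .{{_ : NonZero G}} →
    fromℕ 4 * n * m * G ≤ fromℕ 4 * r * (n * n) * G + m * m * (e * e) →
    1ℚ ÷ n ≤ r ÷ m + (+ 1 / 4) * (e ÷ n) ^ 2 * (m ÷ G)
  clear-denominators n m G r e cleared = *-cancelʳ-≤-pos D {{D-positive}} (begin
    1ℚ * n⁻¹ * D
      ≡⟨ solve 4 (λ n m G n⁻¹ → con 1ℚ :* n⁻¹ :* (con 4ℚ :* (n :* n) :* m :* G)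
           := n :* n⁻¹ :* (con 4ℚ :* n :* m :* G)) refl n m G n⁻¹ ⟩
    n * n⁻¹ * (4ℚ * n * m * G)
      ≡⟨ cong (_* (4ℚ * n * m * G)) (*-inverseʳ n) ⟩
    1ℚ * (4ℚ * n * m * G)
      ≡⟨ *-identityˡ (4ℚ * n * m * G) ⟩
    4ℚ * n * m * G
      ≤⟨ cleared ⟩
    4ℚ * r * (n * n) * G + m * m * (e * e)
      -- The factors `1ℚ` are placeholders for `m * m⁻¹`, `n * n⁻¹` and `G * G⁻¹`, as the ring
      -- solver treats inverses as independent variables.
      ≡⟨ solve 5 (λ n m G r e → con 4ℚ :* r :* (n :* n) :* G :+ m :* m :* (e :* e)
           := con 1ℚ :* (con 4ℚ :* r :* (n :* n) :* G) :+ con 1ℚ :* con 1ℚ :* con 1ℚ :* (m :* m :* (e :* e)))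
           refl n m G r e ⟩
    1ℚ * (4ℚ * r * (n * n) * G) + 1ℚ * 1ℚ * 1ℚ * (m * m * (e * e))
      ≡⟨ cong₂ _+_ (cong (_* (4ℚ * r * (n * n) * G)) (*-inverseʳ m))
           (cong (_* (m * m * (e * e))) (cong₂ (λ x y → x * x * y) (*-inverseʳ n) (*-inverseʳ G))) ⟨
    m * m⁻¹ * (4ℚ * r * (n * n) * G) + n * n⁻¹ * (n * n⁻¹) * (G * G⁻¹) * (m * m * (e * e))
      ≡⟨ solve 8 (λ n m G r e n⁻¹ m⁻¹ G⁻¹ →
           m :* m⁻¹ :* (con 4ℚ :* r :* (n :* n) :* G) :+ n :* n⁻¹ :* (n :* n⁻¹) :* (G :* G⁻¹) :* (m :* m :* (e :* e))
           := (r :* m⁻¹ :+ con ¼ :* (e :* n⁻¹ :* (e :* n⁻¹ :* con 1ℚ)) :* (m :* G⁻¹)) :* (con 4ℚ :* (n :* n) :* m :* G))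
           refl n m G r e n⁻¹ m⁻¹ G⁻¹ ⟩
    (r * m⁻¹ + ¼ * (e * n⁻¹) ^ 2 * (m * G⁻¹)) * D ∎)
    where
    open ≤-Reasoning
    open +-*-Solver
    4ℚ ¼ D n⁻¹ m⁻¹ G⁻¹ : ℚ
    4ℚ  = fromℕ 4
    ¼   = + 1 / 4
    n⁻¹ = 1/ n
    m⁻¹ = 1/ m
    G⁻¹ = 1/ G
    D   = 4ℚ * (n * n) * m * G
    instance
      n²-positive : Positive (n * n)
      n²-positive = pos*pos⇒pos n n
      4n²-positive : Positive (4ℚ * (n * n))
      4n²-positive = pos*pos⇒pos 4ℚ (n * n)
      4n²m-positive : Positive (4ℚ * (n * n) * m)
      4n²m-positive = pos*pos⇒pos (4ℚ * (n * n)) m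
    D-positive : Positive D
    D-positive = pos*pos⇒pos (4ℚ * (n * n) * m) G

  -- Here G stands for q^(k-2) (q - 1), and multiplying by q² avoids the negative
  -- exponent that occurs for k = 1.
  cleared-inequality : ∀ {q n M G S T e} .{{_ : Positive q}} .{{_ : NonNegative (M - 1ℚ)}} →
    G * (q * q) ≡ M * (q - 1ℚ) →
    q * S ≡ n * (q - 1ℚ) * M →
    M * (q - 1ℚ) * n * (n * (q - 1ℚ) + 1ℚ) ≤ q * q * T →
    fromℕ 4 * (M - 1ℚ) * T ≤ fromℕ 4 * (S * S) + (M - 1ℚ) * (M - 1ℚ) * (e * e) →
    fromℕ 4 * n * (M - 1ℚ) * G ≤ fromℕ 4 * (q - 1ℚ) * (n * n) * G + (M - 1ℚ) * (M - 1ℚ) * (e * e)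
  cleared-inequality {q} {n} {M} {G} {S} {T} {e} Gqq≡ qS≡ T≥ T≤ =
    *-cancelʳ-≤-pos (q * q) {{q²-positive}} (begin
    4ℚ * n * m * G * (q * q)
      ≡⟨ solve 4 (λ n m G q → con 4ℚ :* n :* m :* G :* (q :* q)
           := con 4ℚ :* n :* m :* (G :* (q :* q))) refl n m G q ⟩
    4ℚ * n * m * (G * (q * q))
      ≡⟨ cong (4ℚ * n * m *_) Gqq≡ ⟩
    4ℚ * n * m * (M * r)
      -- Isolates the lower bound for `q²T`; the negative remainder `rest` is later absorbed by the
      -- squared first moment.
      ≡⟨ solve 4 (λ n m M r → con 4ℚ :* n :* m :* (M :* r)
           := con 4ℚ :* m :* (M :* r :* n :* (n :* r :+ con 1ℚ)) :+ (:- (con 4ℚ :* m :* (n :* n) :* (r :* r) :* M)))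
           refl n m M r ⟩
    4ℚ * m * (M * r * n * (n * r + 1ℚ)) + rest
      ≤⟨ +-monoˡ-≤ rest (*-monoˡ-≤-nonNeg (4ℚ * m) {{nonNeg*nonNeg⇒nonNeg 4ℚ m}} T≥) ⟩
    4ℚ * m * (q * q * T) + rest
      ≡⟨ cong (_+ rest) (solve 3 (λ m q T → con 4ℚ :* m :* (q :* q :* T)
           := q :* q :* (con 4ℚ :* m :* T)) refl m q T) ⟩
    q * q * (4ℚ * m * T) + rest
      ≤⟨ +-monoˡ-≤ rest (*-monoˡ-≤-nonNeg (q * q) {{pos⇒nonNeg (q * q) {{q²-positive}}}} T≤) ⟩
    q * q * (4ℚ * (S * S) + m * m * (e * e)) + rest
      ≡⟨ cong (_+ rest) (solve 4 (λ q S m e → q :* q :* (con 4ℚ :* (S :* S) :+ m :* m :* (e :* e))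
           := con 4ℚ :* (q :* S :* (q :* S)) :+ m :* m :* (e :* e) :* (q :* q)) refl q S m e) ⟩
    4ℚ * (q * S * (q * S)) + m * m * (e * e) * (q * q) + rest
      ≡⟨ cong (λ x → 4ℚ * (x * x) + m * m * (e * e) * (q * q) + rest) qS≡ ⟩
    4ℚ * (n * r * M * (n * r * M)) + m * m * (e * e) * (q * q) + rest
      -- Since `m = M - 1`, the terms `4n²r²M²` and `- 4mn²r²M` collapse to `4n²r²M`.
      ≡⟨ solve 5 (λ n r M q e → let m = M :- con 1ℚ in
           con 4ℚ :* (n :* r :* M :* (n :* r :* M)) :+ m :* m :* (e :* e) :* (q :* q) :+ (:- (con 4ℚ :* m :* (n :* n) :* (r :* r) :* M))
           := con 4ℚ :* r :* (n :* n) :* (M :* r) :+ m :* m :* (e :* e) :* (q :* q)) refl n r M q e ⟩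
    4ℚ * r * (n * n) * (M * r) + m * m * (e * e) * (q * q)
      ≡⟨ cong (λ x → 4ℚ * r * (n * n) * x + m * m * (e * e) * (q * q)) Gqq≡ ⟨
    4ℚ * r * (n * n) * (G * (q * q)) + m * m * (e * e) * (q * q)
      ≡⟨ solve 6 (λ n r G m e q → con 4ℚ :* r :* (n :* n) :* (G :* (q :* q)) :+ m :* m :* (e :* e) :* (q :* q)
           := (con 4ℚ :* r :* (n :* n) :* G :+ m :* m :* (e :* e)) :* (q :* q)) refl n r G m e q ⟩
    (4ℚ * r * (n * n) * G + m * m * (e * e)) * (q * q) ∎)
    where
    open ≤-Reasoning
    open +-*-Solver
    4ℚ m r rest : ℚ
    4ℚ   = fromℕ 4
    m    = M - 1ℚ
    r    = q - 1ℚ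
    rest = - (4ℚ * m * (n * n) * (r * r) * M)
    q²-positive : Positive (q * q)
    q²-positive = pos*pos⇒pos q q

  -- Over the `M` messages, `S` and `T` are the sums of the weights and of their squares, `Y` and
  -- `U` those of the zero counts.
  cleared-moments : ∀ {q n M S T U Y d w : ℕ} {G} → 0 ℕ.< q → 1 ℕ.< M →
    T ℕ.+ d ℕ.* w ℕ.* M ℕ.≤ (w ℕ.+ d) ℕ.* S ℕ.+ d ℕ.* w →
    S ℕ.+ Y ≡ n ℕ.* M →
    q ℕ.* Y ≡ n ℕ.* M →
    T ℕ.+ 2 ℕ.* n ℕ.* Y ≡ n ℕ.* n ℕ.* M ℕ.+ U →
    n ℕ.* n ℕ.* M ℕ.+ n ℕ.* q ℕ.* M ℕ.≤ q ℕ.* q ℕ.* U ℕ.+ n ℕ.* M →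
    let Q = fromℕ q ; N = fromℕ n ; m = fromℕ M - 1ℚ ; e = fromℕ w - fromℕ d in
    G * (Q * Q) ≡ fromℕ M * (Q - 1ℚ) →
    fromℕ 4 * N * m * G ≤ fromℕ 4 * (Q - 1ℚ) * (N * N) * G + m * m * (e * e)
  cleared-moments {q} {n} {M} {S} {T} {U} {Y} {d} {w} {G} 0<q 1<M T≤ S+Y≡ qY≡ T+≡ U≥ Gqq≡ =
    cleared-inequality {q = fromℕ q} {n = fromℕ n} {M = fromℕ M}
      {S = fromℕ S} {T = fromℕ T} {e = fromℕ w - fromℕ d}
      {{fromℕ-positive 0<q}} {{m≥0}} Gqq≡
      (q*S≡n[q-1]M {q = fromℕ q} {n = fromℕ n} {M = fromℕ M} {S = fromℕ S} {Y = fromℕ Y}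
        (trans (sym (fromℕ-homo-+ S Y)) (trans (cong fromℕ S+Y≡) (fromℕ-homo-* n M))) qY≡′)
      (M[q-1]n[n[q-1]+1]≤q²T {q = fromℕ q} {n = fromℕ n} {M = fromℕ M}
        {T = fromℕ T} {Y = fromℕ Y} {U = fromℕ U} qY≡′
        (trans (sym (trans (fromℕ-homo-+ T (2 ℕ.* n ℕ.* Y)) (cong (_+_ (fromℕ T)) (homo-*₃ 2 n Y))))
          (trans (cong fromℕ T+≡) (trans (fromℕ-homo-+ (n ℕ.* n ℕ.* M) U)
            (cong (_+ fromℕ U) (homo-*₃ n n M)))))
        (≡.subst₂ _≤_
          (trans (fromℕ-homo-+ (n ℕ.* n ℕ.* M) (n ℕ.* q ℕ.* M)) (cong₂ _+_ (homo-*₃ n n M) (homo-*₃ n q M)))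
          (trans (fromℕ-homo-+ (q ℕ.* q ℕ.* U) (n ℕ.* M)) (cong₂ _+_ (homo-*₃ q q U) (fromℕ-homo-* n M)))
          (fromℕ-mono-≤ U≥)))
      (4mT≤4S²+m²[w-d]² (fromℕ M - 1ℚ) {{m≥0}}
        {S = fromℕ S} {T = fromℕ T} {w = fromℕ w} {d = fromℕ d} T≤′)
    where
    m≥0 : NonNegative (fromℕ M - 1ℚ)
    m≥0 = pos⇒nonNeg (fromℕ M - 1ℚ) {{fromℕ-1-positive 1<M}}
    homo-*₃ : ∀ x y z → fromℕ (x ℕ.* y ℕ.* z) ≡ fromℕ x * fromℕ y * fromℕ z
    homo-*₃ x y z = trans (fromℕ-homo-* (x ℕ.* y) z) (cong (_* fromℕ z) (fromℕ-homo-* x y))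
    qY≡′ : fromℕ q * fromℕ Y ≡ fromℕ n * fromℕ M
    qY≡′ = trans (sym (fromℕ-homo-* q Y)) (trans (cong fromℕ qY≡) (fromℕ-homo-* n M))
    -- Moving the zero-message correction `d * w` to the left turns `M` into `M - 1`, the number of
    -- nonzero messages.
    T≤′ : fromℕ T + fromℕ d * fromℕ w * (fromℕ M - 1ℚ) ≤ (fromℕ w + fromℕ d) * fromℕ S
    T≤′ = begin
      fromℕ T + fromℕ d * fromℕ w * (fromℕ M - 1ℚ)
        ≡⟨ solve 3 (λ t x m → t :+ x :* (m :- con 1ℚ)
             := t :+ x :* m :- x) refl (fromℕ T) (fromℕ d * fromℕ w) (fromℕ M) ⟩
      fromℕ T + fromℕ d * fromℕ w * fromℕ M - fromℕ d * fromℕ w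
        ≡⟨ cong (_- dw) (trans (fromℕ-homo-+ T (d ℕ.* w ℕ.* M)) (cong (_+_ (fromℕ T)) (homo-*₃ d w M))) ⟨
      fromℕ (T ℕ.+ d ℕ.* w ℕ.* M) - fromℕ d * fromℕ w
        ≤⟨ +-monoˡ-≤ (- dw) (fromℕ-mono-≤ T≤) ⟩
      fromℕ ((w ℕ.+ d) ℕ.* S ℕ.+ d ℕ.* w) - fromℕ d * fromℕ w
        ≡⟨ cong (_- dw) (trans (fromℕ-homo-+ ((w ℕ.+ d) ℕ.* S) (d ℕ.* w)) (cong₂ _+_
             (trans (fromℕ-homo-* (w ℕ.+ d) S) (cong (_* fromℕ S) (fromℕ-homo-+ w d)))
             (fromℕ-homo-* d w))) ⟩
      (fromℕ w + fromℕ d) * fromℕ S + dw - dw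
        ≡⟨ solve 2 (λ x y → x :+ y :- y := x) refl ((fromℕ w + fromℕ d) * fromℕ S) dw ⟩
      (fromℕ w + fromℕ d) * fromℕ S ∎
      where
      open ≤-Reasoning
      open +-*-Solver
      dw : ℚ
      dw = fromℕ d * fromℕ w

-- The weight-spread inequality for nondegenerate codes.

open import Defs
open WeightMoments
open RationalInequalities
open import Data.Integer.Base using (+_) renaming (_-_ to _-ᶻ_)
open import Data.Nat.Base using () renaming (_≤_ to _≤ᴺ_)
open import Data.Nat.Properties using (≤-trans; <⇒≤)
open import Data.Rational.Base using (0ℚ; 1ℚ; _+_; _-_; _*_; _÷_; _/_; _≤_; _<_; NonZero; Positive; positive)
import Data.Rational.Properties as ℚ
open import Data.Rational.Solver using (module +-*-Solver)
open import Relation.Binary.PropositionalEquality using (sym; trans; subst)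
open import Relation.Unary using (Pred)

proposition3p10 :
    ∀ {c ℓ₁ ℓ₂ ℓ} (q n k d w : ℕ)
    (q-primePower : IsPrimePower q) (k≤n : k ≤ᴺ n) (1≤k : 1 ≤ᴺ k)
    (F : FiniteField q c ℓ₁ ℓ₂) →
    let open LinearCodes F in
    (C : Pred (Word n) ℓ) →
    IsCode C k d → Nondegenerate C → MaximumWeight C w →
    let Q = fromℕ q
        N = fromℕ n
        1<q = primePower>1 q-primePower
        instance
          Q-nonZero : NonZero Q
          Q-nonZero = nonZero-fromℕ (<⇒≤ 1<q)
          N-nonZero : NonZero N
          N-nonZero = nonZero-fromℕ (≤-trans 1≤k k≤n)
          Q^k-1-nonZero : NonZero (Q ^ k - 1ℚ)
          Q^k-1-nonZero = nonZero-Q^k-1 1<q 1≤k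
          Q^[k-2][Q-1]-nonZero : NonZero (Q ^ᶻ (+ k -ᶻ + 2) * (Q - 1ℚ))
          Q^[k-2][Q-1]-nonZero = nonZero-Q^z[Q-1] 1<q (+ k -ᶻ + 2)
    in
    1ℚ ÷ N ≤
      (Q - 1ℚ) ÷ (Q ^ k - 1ℚ)
      + (+ 1 / 4) * ((fromℕ w - fromℕ d) ÷ N) ^ 2
        * ((Q ^ k - 1ℚ) ÷ (Q ^ᶻ (+ k -ᶻ + 2) * (Q - 1ℚ)))
proposition3p10 q n k d w q-primePower k≤n 1≤k F C isCode nondegenerate (_ , ω≤w) =
  clear-denominators N (Q ^ k - 1ℚ) G (Q - 1ℚ) (fromℕ w - fromℕ d)
    {{fromℕ-positive (≤-trans 1≤k k≤n)}} {{m-positive}} {{positive 0<G}}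
    {{nonZero-fromℕ (≤-trans 1≤k k≤n)}} {{nonZero-Q^k-1 1<q 1≤k}} {{nonZero-Q^z[Q-1] 1<q (+ k -ᶻ + 2)}}
    -- The counting gives `q ^ k` as a natural number, the goal a power of the rational `Q`.
    (subst (λ M → fromℕ 4 * N * (M - 1ℚ) * G ≤
                  fromℕ 4 * (Q - 1ℚ) * (N * N) * G + (M - 1ℚ) * (M - 1ℚ) * (e * e))
      (fromℕ-homo-^ q k)
      (cleared-moments {n = n} {d = d} {w = w} (<⇒≤ 1<q) 1<q^k
        (∑ω²-≤ F b (λ a → ω≤w (_ , encode∈C a , refl))
          -- Independence of the basis makes the codeword of a nonzero message nonzero, so its
          -- weight is at least `d`.
          λ {a} 0≉a → proj₂ minimumDistance
            (_ , encode∈C a , (λ encode≋0 → 0≉a (λ j → FF.sym (independent a encode≋0 j))) , refl))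
        (∑ω+∑zeros F b) (q*∑zeros F b nondegenerate′)
        (∑ω²+2n∑zeros F b) (∑zeros²-≥ F b nondegenerate′) Gqq≡))
  where
  open LinearCodes F using (module IsCode; module IsBasis)
  open IsCode isCode using (isSubspace; dimension; minimumDistance)
  module FF = FiniteField F
  Q = fromℕ q
  N = fromℕ n
  1<q = primePower>1 q-primePower
  e = fromℕ w - fromℕ d
  b = proj₁ dimension
  open IsBasis (proj₂ dimension) using (members; independent)
  encode∈C = encode-closed F isSubspace b members
  nondegenerate′ = basis-nondegenerate F (proj₂ dimension) nondegenerate
  instance
    Q-nonZero : NonZero Q
    Q-nonZero = nonZero-fromℕ (<⇒≤ 1<q)
  G = Q ^ᶻ (+ k -ᶻ + 2) * (Q - 1ℚ)
  1<q^k : 1 ℕ.< q ℕ.^ k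
  1<q^k = ℕ.≤-trans 1<q (≡.subst (ℕ._≤ q ℕ.^ k) (ℕ.*-identityʳ q)
    (ℕ.^-monoʳ-≤ q {{ℕ.>-nonZero (<⇒≤ 1<q)}} 1≤k))
  m-positive : Positive (Q ^ k - 1ℚ)
  m-positive = subst (λ M → Positive (M - 1ℚ)) (fromℕ-homo-^ q k) (fromℕ-1-positive 1<q^k)
  Gqq≡ : G * (Q * Q) ≡ fromℕ (q ℕ.^ k) * (Q - 1ℚ)
  Gqq≡ = begin
    Q ^ᶻ (+ k -ᶻ + 2) * (Q - 1ℚ) * (Q * Q)
      ≡⟨ solve 3 (λ p r s → p :* r :* s := p :* s :* r) refl (Q ^ᶻ (+ k -ᶻ + 2)) (Q - 1ℚ) (Q * Q) ⟩
    Q ^ᶻ (+ k -ᶻ + 2) * (Q * Q) * (Q - 1ℚ)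
      ≡⟨ cong (_* (Q - 1ℚ)) (trans (^ᶻ[k-2]*p*p Q 1≤k) (sym (fromℕ-homo-^ q k))) ⟩
    fromℕ (q ℕ.^ k) * (Q - 1ℚ)              ∎
    where
    open ≡.≡-Reasoning
    open +-*-Solver
  -- Cancelling `Q * Q` in `Gqq≡` avoids a case split on the sign of the exponent.
  0<G : 0ℚ < G
  0<G = ℚ.*-cancelʳ-<-nonNeg (Q * Q)
    {{ℚ.pos⇒nonNeg (Q * Q) {{ℚ.pos*pos⇒pos Q {{Q-positive}} Q {{Q-positive}}}}}}
    (≡.subst₂ _<_ (sym (ℚ.*-zeroˡ (Q * Q))) (sym Gqq≡)
      (ℚ.positive⁻¹ _ {{ℚ.pos*pos⇒pos (fromℕ (q ℕ.^ k)) {{fromℕ-positive (<⇒≤ 1<q^k)}}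
                                        (Q - 1ℚ) {{fromℕ-1-positive 1<q}}}}))
    where
    Q-positive : Positive Q
    Q-positive = fromℕ-positive (<⇒≤ 1<q)
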